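{- Let $k>0$ be an integer. If $G$ is a finite graph with $2k-2<{\rm mad}(G)\le 2k$, then \[ {\rm col}(G^{2})\le (2k-1)\Delta(G)+2k+1, \] where $\Delta(G)$ is the maximum degree of $G$.
   Context: The maximum average degree is ${\rm mad}(G)=\max_{\emptyset\ne H\subseteq G}\frac{2\|H\|}{|H|}$ (number of edges over number of vertices). The square $G^{2}$ of $G=(V,E)$ is the graph on $V$ in which $x\ne y$ are adjacent iff their distance in $G$ is at most $2$. For a graph $H$, the coloring number is ${\rm col}(H)=\min_{\sigma}\max_{x\in V(H)}|N_H[x]\cap\{y: y\le_\sigma x\}|$, where $\sigma$ ranges over total orderings of $V(H)$ and $N_H[x]$ is the closed neighborhood of $x$ in $H$. -}

module Defs where

open import Data.Nat using (ℕ; zero; suc; _+_; _*_; _⊔_; _≤_; _<_)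
open import Data.Bool using (Bool; true; false; _∧_; _∨_; not; if_then_else_)
open import Data.Fin using (Fin; zero; suc; _≟_) renaming (_≤_ to _≤ᶠ_)
open import Data.Fin.Properties using () renaming (_≤?_ to _≤ᶠ?_)
open import Data.Product using (Σ; _×_; ∃-syntax)
open import Relation.Binary.PropositionalEquality using (_≡_)
open import Relation.Nullary.Decidable using (⌊_⌋)
open import Function.Definitions using (Injective)

record Graph : Set where
  field
    n      : ℕ
    adj    : Fin n → Fin n → Bool
    sym    : ∀ x y → adj x y ≡ adj y x
    irrefl : ∀ x → adj x x ≡ false
open Graph public

count : ∀ {m} → (Fin m → Bool) → ℕ
count {zero}  p = 0
count {suc m} p = (if p zero then 1 else 0) + count (λ i → p (suc i))

anyF : ∀ {m} → (Fin m → Bool) → Bool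
anyF {zero}  p = false
anyF {suc m} p = p zero ∨ anyF (λ i → p (suc i))

maxF : ∀ {m} → (Fin m → ℕ) → ℕ
maxF {zero}  f = 0
maxF {suc m} f = f zero ⊔ maxF (λ i → f (suc i))

deg : (G : Graph) → Fin (n G) → ℕ
deg G x = count (adj G x)

Δ : Graph → ℕ
Δ G = maxF (deg G)

VSubset : Graph → Set
VSubset G = Fin (n G) → Bool

∣_∣ᵥ : ∀ {m} → (Fin m → Bool) → ℕ
∣ S ∣ᵥ = count S

-- ‖H‖ for the induced subgraph on S: number of edges with both ends in S.
-- Each edge {x,y} is counted twice in the double sum, so this is 2‖G[S]‖.
twiceEdges : (G : Graph) → VSubset G → ℕ
twiceEdges G S = sumF (λ x → count (λ y → S x ∧ S y ∧ adj G x y))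
  where
  sumF : (Fin (n G) → ℕ) → ℕ
  sumF = go
    where
    go : ∀ {m} → (Fin m → ℕ) → ℕ
    go {zero}  f = 0
    go {suc m} f = f zero + go (λ i → f (suc i))

-- mad(G) = max over nonempty subgraphs H of 2‖H‖/|H|. The maximum is attained
-- by induced subgraphs, and "mad(G) ≤ a / mad(G) > a" unfold as follows
-- (for natural a), avoiding rationals.
madLe : Graph → ℕ → Set
madLe G a = ∀ (S : VSubset G) → twiceEdges G S ≤ a * ∣ S ∣ᵥ

madGt : Graph → ℕ → Set
madGt G a = Σ (VSubset G) λ S → (0 < ∣ S ∣ᵥ × a * ∣ S ∣ᵥ < twiceEdges G S)

adj² : (G : Graph) → Fin (n G) → Fin (n G) → Bool
adj² G x y = not ⌊ x ≟ y ⌋ ∧ (adj G x y ∨ anyF (λ z → adj G x z ∧ adj G z y))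

-- col(H) ≤ c for a graph H on Fin m given by its adjacency:
-- some total ordering σ of V(H) (given by an injective rank function)
-- with |N_H[x] ∩ {y : y ≤_σ x}| ≤ c for every x.
colLe : ∀ {m} → (Fin m → Fin m → Bool) → ℕ → Set
colLe {m} A c =
  Σ (Fin m → Fin m) λ σ → Injective {A = Fin m} {B = Fin m} _≡_ _≡_ σ ×
    (∀ x → count (λ y → (⌊ y ≟ x ⌋ ∨ A x y) ∧ ⌊ σ y ≤ᶠ? σ x ⌋) ≤ c)

{-# OPTIONS --safe #-}

-- A vertex set S is peeled off one vertex at a time, always removing a vertex
-- whose closed neighbourhood in G² meets S in at most c = (2k−1)Δ + 2k + 1
-- vertices; such a vertex exists because c bounds the average over S.
-- Write s(z) = |N(z) ∩ S|.  The closed G²-neighbourhoods within S contribute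
-- at most |S| + 2‖G[S]‖ + Σ_z s(z)(s(z) − 1).  With Z = {z : k ≤ s(z)},
-- applying mad(G) ≤ 2k to both Z ∪ S and Z ∩ S gives Σ_z (s(z) ∸ k) ≤ k|S|.
-- Since s(z)² ≤ k s(z) + Δ (s(z) ∸ k) and Σ_z s(z) ≤ Δ|S|, the last sum is at
-- most (k−1)Δ|S| + kΔ|S|.

module Submission where

open import Defs
open import Data.Nat using (ℕ; zero; suc; _+_; _*_; _∸_; _≤_; _<_; z≤n; s≤s; _≤?_)
open import Data.Nat.Properties hiding (_≟_)
open import Data.Nat.Tactic.RingSolver using (solve-∀)
open import Data.Bool using (Bool; true; false; _∧_; _∨_; not; if_then_else_)
open import Data.Bool.Properties using (∧-idem) renaming (_≟_ to _≟ᵇ_)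
open import Data.Fin using (Fin; zero; suc; _≟_; toℕ; fromℕ<)
open import Data.Fin.Properties using (any?; toℕ-fromℕ<; fromℕ<-injective) renaming (_≤?_ to _≤ᶠ?_)
open import Data.Product using (_×_; _,_; proj₁; proj₂; ∃-syntax)
open import Relation.Nullary using (Dec; yes; no; contradiction)
open import Relation.Nullary.Decidable using (⌊_⌋; _×-dec_)
open import Relation.Binary.PropositionalEquality as ≡ using (_≡_; _≢_; refl; cong; cong₂; trans; subst)
open import Function using (_∘_)
open import Algebra.Properties.Semiring.Sum +-*-semiring using (sum; sum-cong-≗; ∑-distrib-+; ∑-comm; *-distribˡ-sum; *-distribʳ-sum)

private
  variable
    m : ℕ

-- Truth values as the numbers 0 and 1

ι : Bool → ℕ
ι b = if b then 1 else 0

ι-∧ : ∀ p q → ι (p ∧ q) ≡ ι p * ι q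
ι-∧ true  q = ≡.sym (*-identityˡ (ι q))
ι-∧ false q = refl

ι-∨ : ∀ p q → ι (p ∨ q) ≤ ι p + ι q
ι-∨ true  q = m≤m+n 1 (ι q)
ι-∨ false q = ≤-refl

ι-mono : ∀ {p q} → (p ≡ true → q ≡ true) → ι p ≤ ι q
ι-mono {false}     p⇒q = z≤n
ι-mono {true}  {q} p⇒q rewrite p⇒q refl = ≤-refl

∧-true : ∀ {p q} → p ∧ q ≡ true → p ≡ true × q ≡ true
∧-true {true} q≡true = refl , q≡true

true-∧ : ∀ {p q} → p ≡ true → q ≡ true → p ∧ q ≡ true
true-∧ refl refl = refl

-- Sums and counts

sum-mono : {f g : Fin m → ℕ} → (∀ i → f i ≤ g i) → sum f ≤ sum g
sum-mono {zero}  f≤g = z≤n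
sum-mono {suc m} f≤g = +-mono-≤ (f≤g zero) (sum-mono (f≤g ∘ suc))

∑∑-distrib-+ : (f g : Fin m → Fin m → ℕ) →
  sum (λ x → sum (λ y → f x y + g x y)) ≡ sum (λ x → sum (f x)) + sum (λ x → sum (g x))
∑∑-distrib-+ f g =
  trans (sum-cong-≗ λ x → ∑-distrib-+ (f x) (g x)) (∑-distrib-+ (sum ∘ f) (sum ∘ g))

count≡sum : (p : Fin m → Bool) → count p ≡ sum (ι ∘ p)
count≡sum {zero}  p = refl
count≡sum {suc m} p = cong (ι (p zero) +_) (count≡sum (p ∘ suc))

count-cong : {p q : Fin m → Bool} → (∀ i → p i ≡ q i) → count p ≡ count q
count-cong {zero}  p≗q = refl
count-cong {suc m} p≗q = cong₂ _+_ (cong ι (p≗q zero)) (count-cong (p≗q ∘ suc))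

count-mono : {p q : Fin m → Bool} → (∀ i → p i ≡ true → q i ≡ true) → count p ≤ count q
count-mono {zero}  p⇒q = z≤n
count-mono {suc m} p⇒q = +-mono-≤ (ι-mono (p⇒q zero)) (count-mono (p⇒q ∘ suc))

count-true : ∀ m → count {m} (λ _ → true) ≡ m
count-true zero    = refl
count-true (suc m) = cong suc (count-true m)

count-∧ˡ : ∀ b (p : Fin m → Bool) → count (λ i → b ∧ p i) ≡ ι b * count p
count-∧ˡ         true  p = ≡.sym (*-identityˡ (count p))
count-∧ˡ {zero}  false p = refl
count-∧ˡ {suc m} false p = count-∧ˡ false (p ∘ suc)

count-∧ : (p q : Fin m → Bool) → count (λ i → p i ∧ q i) ≡ sum (λ i → ι (p i) * ι (q i))
count-∧ p q = trans (count≡sum (λ i → p i ∧ q i)) (sum-cong-≗ λ i → ι-∧ (p i) (q i))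

count-∪-∩ : (p q : Fin m → Bool) →
  count (λ i → p i ∨ q i) + count (λ i → p i ∧ q i) ≡ count p + count q
count-∪-∩ p q = begin
  count (λ i → p i ∨ q i) + count (λ i → p i ∧ q i)
    ≡⟨ cong₂ _+_ (count≡sum λ i → p i ∨ q i) (count≡sum λ i → p i ∧ q i) ⟩
  sum (λ i → ι (p i ∨ q i)) + sum (λ i → ι (p i ∧ q i))
    ≡⟨ ∑-distrib-+ (λ i → ι (p i ∨ q i)) (λ i → ι (p i ∧ q i)) ⟨
  sum (λ i → ι (p i ∨ q i) + ι (p i ∧ q i))
    ≡⟨ sum-cong-≗ (λ i → pointwise (p i) (q i)) ⟩
  sum (λ i → ι (p i) + ι (q i))
    ≡⟨ ∑-distrib-+ (ι ∘ p) (ι ∘ q) ⟩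
  sum (ι ∘ p) + sum (ι ∘ q)
    ≡⟨ cong₂ _+_ (count≡sum p) (count≡sum q) ⟨
  count p + count q ∎
  where
  open ≡.≡-Reasoning
  pointwise : ∀ a b → ι (a ∨ b) + ι (a ∧ b) ≡ ι a + ι b
  pointwise true  b = refl
  pointwise false b = +-identityʳ (ι b)

ι-anyF≤count : (p : Fin m → Bool) → ι (anyF p) ≤ count p
ι-anyF≤count {zero}  p = z≤n
ι-anyF≤count {suc m} p =
  ≤-trans (ι-∨ (p zero) _) (+-monoʳ-≤ (ι (p zero)) (ι-anyF≤count (p ∘ suc)))

≤maxF : (f : Fin m → ℕ) → ∀ i → f i ≤ maxF f
≤maxF f zero    = m≤m⊔n _ _
≤maxF f (suc i) = ≤-trans (≤maxF (f ∘ suc) i) (m≤n⊔m (f zero) _)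

-- The indicator of `y = x` acts as a Kronecker delta. It brings a quantity attached to the single
-- vertex `x` under a sum over `y`, so that later estimates can be made term by term.
sum-point : (x : Fin m) (f : Fin m → ℕ) → sum (λ y → ι ⌊ y ≟ x ⌋ * f y) ≡ f x
sum-point {suc m} zero f =
  trans (cong₂ _+_ (*-identityˡ (f zero)) (sum-zero m)) (+-identityʳ (f zero))
  where
  sum-zero : ∀ m → sum {m} (λ _ → 0) ≡ 0
  sum-zero zero    = refl
  sum-zero (suc m) = sum-zero m
sum-point {suc m} (suc x) f =
  trans (sum-cong-≗ λ y → cong (λ b → ι b * f (suc y)) (suc-≟ y)) (sum-point x (f ∘ suc))
  where
  suc-≟ : ∀ y → ⌊ Fin.suc y ≟ suc x ⌋ ≡ ⌊ y ≟ x ⌋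
  suc-≟ y with y ≟ x
  ... | yes _ = refl
  ... | no  _ = refl

count-remove : (p : Fin m → Bool) (x : Fin m) → p x ≡ true →
  count p ≡ suc (count (λ y → p y ∧ not ⌊ y ≟ x ⌋))
count-remove {m} p x px = begin
  count p
    ≡⟨ count≡sum p ⟩
  sum (ι ∘ p)
    ≡⟨ sum-cong-≗ pointwise ⟩
  sum (λ y → ι ⌊ y ≟ x ⌋ * 1 + ι (p′ y))
    ≡⟨ ∑-distrib-+ (λ y → ι ⌊ y ≟ x ⌋ * 1) (ι ∘ p′) ⟩
  sum (λ y → ι ⌊ y ≟ x ⌋ * 1) + sum (ι ∘ p′)
    ≡⟨ cong₂ _+_ (sum-point x (λ _ → 1)) (≡.sym (count≡sum p′)) ⟩
  suc (count p′) ∎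
  where
  open ≡.≡-Reasoning
  p′ : Fin m → Bool
  p′ y = p y ∧ not ⌊ y ≟ x ⌋
  pointwise : ∀ y → ι (p y) ≡ ι ⌊ y ≟ x ⌋ * 1 + ι (p′ y)
  pointwise y with y ≟ x
  ... | yes refl rewrite px = refl
  ... | no  _ with p y
  ...   | true  = refl
  ...   | false = refl

-- Otherwise `f` is at least `suc c` throughout `p`, and the sum is at least `suc c * count p`. This
-- exceeds `c * count p` because `p` is nonempty.
∃≤average : (p : Fin m → Bool) (f : Fin m → ℕ) (c : ℕ) → 0 < count p →
  sum (λ x → ι (p x) * f x) ≤ c * count p → ∃[ x ] p x ≡ true × f x ≤ c
∃≤average p f c 0<p average with any? (λ x → (p x ≟ᵇ true) ×-dec (f x ≤? c))
... | yes found = found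
... | no  none  = contradiction total (<⇒≱ (m<n+m (c * count p) 0<p))
  where
  pointwise : ∀ x → ι (p x) * suc c ≤ ι (p x) * f x
  pointwise x with p x in px
  ... | true  = *-monoʳ-≤ 1 (≰⇒> λ fx≤c → none (x , px , fx≤c))
  ... | false = z≤n
  open ≤-Reasoning
  total : suc c * count p ≤ c * count p
  total = begin
    suc c * count p               ≡⟨ *-comm (suc c) (count p) ⟩
    count p * suc c               ≡⟨ cong (_* suc c) (count≡sum p) ⟩
    sum (ι ∘ p) * suc c           ≡⟨ *-distribʳ-sum (suc c) (ι ∘ p) ⟩
    sum (λ x → ι (p x) * suc c)   ≤⟨ sum-mono pointwise ⟩
    sum (λ x → ι (p x) * f x)     ≤⟨ average ⟩
    c * count p                   ∎

-- Degenerate orderings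

-- A partial ordering still under construction: all conditions concern `S` alone, and ranks outside
-- `S` are arbitrary. Thus `S` can shrink while the vertex type `Fin m` stays fixed.
record Ranking (B : Fin m → Fin m → Bool) (c j : ℕ) (S : Fin m → Bool) : Set where
  field
    rank      : Fin m → ℕ
    bounded   : ∀ x → S x ≡ true → rank x < j
    injective : ∀ x y → S x ≡ true → S y ≡ true → rank x ≡ rank y → x ≡ y
    sparse    : ∀ x → S x ≡ true → count (λ y → (S y ∧ B x y) ∧ ⌊ rank y ≤? rank x ⌋) ≤ c

Degenerate : (Fin m → Fin m → Bool) → ℕ → Set
Degenerate {m} B c = (S : Fin m → Bool) → 0 < count S →
  ∃[ x ] S x ≡ true × count (λ y → S y ∧ B x y) ≤ c

-- Induction on the size of `S`: a vertex with few `B`-neighbours in `S` is placed last, and the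
-- remaining vertices are ranked recursively.
degenerate⇒ranking : (B : Fin m → Fin m → Bool) (c : ℕ) → Degenerate B c →
  ∀ j S → count S ≡ j → Ranking B c j S
degenerate⇒ranking B c degenerate zero S ∣S∣≡0 = record
  { rank      = λ _ → 0
  ; bounded   = λ x Sx → contradiction Sx (empty x)
  ; injective = λ x _ Sx → contradiction Sx (empty x)
  ; sparse    = λ x Sx → contradiction Sx (empty x)
  }
  where
  empty : ∀ x → S x ≢ true
  empty x Sx = contradiction (trans (≡.sym ∣S∣≡0) (count-remove S x Sx)) λ ()
degenerate⇒ranking {m} B c degenerate (suc j) S ∣S∣≡1+j = record
  { rank      = rank
  ; bounded   = bounded
  ; injective = injective
  ; sparse    = sparse
  }
  where
  chosen = degenerate S (subst (0 <_) (≡.sym ∣S∣≡1+j) (s≤s z≤n))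
  last = proj₁ chosen
  S′ : Fin m → Bool
  S′ y = S y ∧ not ⌊ y ≟ last ⌋
  module R = Ranking (degenerate⇒ranking B c degenerate j S′
    (suc-injective (trans (≡.sym (count-remove S last (proj₁ (proj₂ chosen)))) ∣S∣≡1+j)))

  rank : Fin m → ℕ
  -- The recursive ranks on `S′` lie below `j`, so `j` is free and puts `last` on top.
  rank y = if ⌊ y ≟ last ⌋ then j else R.rank y

  S′-intro : ∀ {y} → S y ≡ true → y ≢ last → S′ y ≡ true
  S′-intro {y} Sy y≢last with y ≟ last
  ... | yes y≡last = contradiction y≡last y≢last
  ... | no  _      = true-∧ Sy refl

  rank-last : rank last ≡ j
  rank-last with last ≟ last
  ... | yes _  = refl
  ... | no  ne = contradiction refl ne

  rank-other : ∀ {y} → y ≢ last → rank y ≡ R.rank y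
  rank-other {y} y≢last with y ≟ last
  ... | yes y≡last = contradiction y≡last y≢last
  ... | no  _      = refl

  rank-other< : ∀ {y} → S y ≡ true → y ≢ last → rank y < j
  rank-other< Sy y≢last =
    subst (_< j) (≡.sym (rank-other y≢last)) (R.bounded _ (S′-intro Sy y≢last))

  bounded : ∀ x → S x ≡ true → rank x < suc j
  bounded x Sx with x ≟ last
  ... | yes refl   = ≤-refl
  ... | no  x≢last = m<n⇒m<1+n (R.bounded x (S′-intro Sx x≢last))

  injective : ∀ x y → S x ≡ true → S y ≡ true → rank x ≡ rank y → x ≡ y
  injective x y Sx Sy eq = helper (x ≟ last) (y ≟ last)
    where
    helper : Dec (x ≡ last) → Dec (y ≡ last) → x ≡ y
    helper (yes x≡last) (yes y≡last) = trans x≡last (≡.sym y≡last)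
    -- When exactly one of the two vertices is `last`, its rank is `j` and the other rank is
    -- smaller.
    helper (yes refl)   (no y≢last)  =
      contradiction (trans (≡.sym eq) rank-last) (<⇒≢ (rank-other< Sy y≢last))
    helper (no x≢last)  (yes refl)   =
      contradiction (trans eq rank-last) (<⇒≢ (rank-other< Sx x≢last))
    helper (no x≢last)  (no y≢last)  =
      R.injective x y (S′-intro Sx x≢last) (S′-intro Sy y≢last)
        (trans (≡.sym (rank-other x≢last)) (trans eq (rank-other y≢last)))

  ⌊≤?⌋-elim : ∀ {a b} → ⌊ a ≤? b ⌋ ≡ true → a ≤ b
  ⌊≤?⌋-elim {a} {b} _ with a ≤? b
  ⌊≤?⌋-elim _  | yes a≤b = a≤b
  ⌊≤?⌋-elim () | no _

  sparse : ∀ x → S x ≡ true → count (λ y → (S y ∧ B x y) ∧ ⌊ rank y ≤? rank x ⌋) ≤ c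
  sparse x Sx with x ≟ last
  -- For `last` the rank condition is simply dropped: degeneracy already bounds the count over all
  -- of `S`.
  ... | yes refl   = ≤-trans (count-mono λ y → proj₁ ∘ ∧-true {p = S y ∧ B last y}) (proj₂ (proj₂ chosen))
  ... | no  x≢last = ≤-trans (count-mono step) (R.sparse x (S′-intro Sx x≢last))
    where
    step : ∀ y → (S y ∧ B x y) ∧ ⌊ rank y ≤? R.rank x ⌋ ≡ true →
           (S′ y ∧ B x y) ∧ ⌊ R.rank y ≤? R.rank x ⌋ ≡ true
    step y hyp with y ≟ last
    -- For any other `x`, the vertex `last` is not counted, since that would give
    -- `j ≤ R.rank x < j`. The count is therefore the recursive one over `S′`.
    ... | yes refl   = contradiction (⌊≤?⌋-elim (proj₂ (∧-true {p = S y ∧ B x y} hyp)))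
                         (<⇒≱ (R.bounded x (S′-intro Sx x≢last)))
    ... | no  y≢last with ∧-true {p = S y ∧ B x y} hyp
    ...   | SB , r≤ with ∧-true {p = S y} SB
    ...     | Sy , Bxy = true-∧ (true-∧ (true-∧ Sy refl) Bxy) r≤

degenerate⇒colLe : (A : Fin m → Fin m → Bool) (c : ℕ) →
  Degenerate (λ x y → ⌊ y ≟ x ⌋ ∨ A x y) c → colLe A c
degenerate⇒colLe {m} A c degenerate = σ , σ-injective , σ-sparse
  where
  -- With `S` the whole vertex set the ranks lie below `m`, so they are elements of `Fin m`, as
  -- `colLe` demands.
  open Ranking (degenerate⇒ranking _ c degenerate m (λ _ → true) (count-true m))
  rank<m : ∀ x → rank x < m
  rank<m x = bounded x refl
  σ : Fin m → Fin m
  σ x = fromℕ< (rank<m x)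
  σ-injective : ∀ {x y} → σ x ≡ σ y → x ≡ y
  σ-injective {x} {y} eq =
    injective x y refl refl (fromℕ<-injective _ _ (rank<m x) (rank<m y) eq)
  σ-sparse : ∀ x → count (λ y → (⌊ y ≟ x ⌋ ∨ A x y) ∧ ⌊ σ y ≤ᶠ? σ x ⌋) ≤ c
  σ-sparse x = ≤-trans (count-mono step) (sparse x refl)
    where
    -- The order on `Fin` compares the values of `toℕ`. Naming these values `a` and `b` lets `refl`
    -- exchange them for the ranks inside the decision.
    ⌊≤?⌋-transport : ∀ {a b} y → toℕ (σ y) ≡ a → toℕ (σ x) ≡ b →
      ⌊ σ y ≤ᶠ? σ x ⌋ ≡ true → ⌊ a ≤? b ⌋ ≡ true
    ⌊≤?⌋-transport y refl refl hyp = hyp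
    step : ∀ y → (⌊ y ≟ x ⌋ ∨ A x y) ∧ ⌊ σ y ≤ᶠ? σ x ⌋ ≡ true →
           (true ∧ (⌊ y ≟ x ⌋ ∨ A x y)) ∧ ⌊ rank y ≤? rank x ⌋ ≡ true
    step y hyp with ∧-true {p = ⌊ y ≟ x ⌋ ∨ A x y} hyp
    ... | near , σ≤ = true-∧ near
      (⌊≤?⌋-transport y (toℕ-fromℕ< (rank<m y)) (toℕ-fromℕ< (rank<m x)) σ≤)

-- Edge counts

degIn : (G : Graph) → VSubset G → Fin (n G) → ℕ
degIn G S x = count (λ y → S y ∧ adj G x y)

-- Ordered pairs are counted, so an edge with both ends in `A` and in `B` contributes 2; this agrees
-- with `twiceEdges` when `A` and `B` coincide.
crossEdges : (G : Graph) → VSubset G → VSubset G → ℕ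
crossEdges G A B = sum (λ x → count (λ y → A x ∧ B y ∧ adj G x y))

-- The summation inside twiceEdges is local to it and cannot be named; the
-- underscore in the type of local-sum is solved to it, by unification, when
-- twiceEdges≡crossEdges is checked.
mutual
  twiceEdges≡crossEdges : ∀ G S → twiceEdges G S ≡ crossEdges G S S
  twiceEdges≡crossEdges G S with n G | (λ x → count (λ y → S x ∧ S y ∧ adj G x y))
  ... | m | f = local-sum G S m f

  local-sum : ∀ (G : Graph) (S : VSubset G) m (f : Fin m → ℕ) → _ ≡ sum f
  local-sum G S zero    f = refl
  local-sum G S (suc m) f = cong (f zero +_) (local-sum G S m _)

module _ (G : Graph) where

  crossEdges≡sum-degIn : ∀ A B → crossEdges G A B ≡ sum (λ x → ι (A x) * degIn G B x)
  crossEdges≡sum-degIn A B = sum-cong-≗ λ x → count-∧ˡ (A x) (λ y → B y ∧ adj G x y)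

  crossEdges≡∑∑ : ∀ A B → crossEdges G A B ≡ sum (λ x → sum (λ y → ι (A x ∧ B y ∧ adj G x y)))
  crossEdges≡∑∑ A B = sum-cong-≗ λ x → count≡sum (λ y → A x ∧ B y ∧ adj G x y)

  crossEdges-sym : ∀ A B → crossEdges G A B ≡ crossEdges G B A
  crossEdges-sym A B = begin
    crossEdges G A B
      ≡⟨ crossEdges≡∑∑ A B ⟩
    sum (λ x → sum (λ y → ι (A x ∧ B y ∧ adj G x y)))
      ≡⟨ ∑-comm (λ x y → ι (A x ∧ B y ∧ adj G x y)) ⟩
    sum (λ y → sum (λ x → ι (A x ∧ B y ∧ adj G x y)))
      ≡⟨ sum-cong-≗ (λ y → sum-cong-≗ λ x → cong ι (swap x y)) ⟩
    sum (λ y → sum (λ x → ι (B y ∧ A x ∧ adj G y x)))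
      ≡⟨ crossEdges≡∑∑ B A ⟨
    crossEdges G B A ∎
    where
    open ≡.≡-Reasoning
    swap : ∀ x y → A x ∧ B y ∧ adj G x y ≡ B y ∧ A x ∧ adj G y x
    swap x y rewrite Graph.sym G x y with A x | B y
    ... | true  | true  = refl
    ... | true  | false = refl
    ... | false | true  = refl
    ... | false | false = refl

  -- Checked for each ordered pair `(x , y)`. If it is counted once on the left, both ends lie in
  -- the union. If it is counted twice, both ends lie in the intersection, hence in the union as
  -- well.
  crossEdges-uncross : ∀ A B → crossEdges G A B + crossEdges G B A
    ≤ twiceEdges G (λ x → A x ∨ B x) + twiceEdges G (λ x → A x ∧ B x)
  crossEdges-uncross A B = begin
    crossEdges G A B + crossEdges G B A
      ≡⟨ cong₂ _+_ (crossEdges≡∑∑ A B) (crossEdges≡∑∑ B A) ⟩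
    sum (λ x → sum (e A B x)) + sum (λ x → sum (e B A x))
      ≡⟨ ∑∑-distrib-+ (e A B) (e B A) ⟨
    sum (λ x → sum (λ y → e A B x y + e B A x y))
      ≤⟨ sum-mono (λ x → sum-mono λ y → pointwise (A x) (B x) (A y) (B y) (adj G x y)) ⟩
    sum (λ x → sum (λ y → e A∪B A∪B x y + e A∩B A∩B x y))
      ≡⟨ ∑∑-distrib-+ (e A∪B A∪B) (e A∩B A∩B) ⟩
    sum (λ x → sum (e A∪B A∪B x)) + sum (λ x → sum (e A∩B A∩B x))
      ≡⟨ cong₂ _+_ (twiceEdges≡∑∑ A∪B) (twiceEdges≡∑∑ A∩B) ⟨
    twiceEdges G A∪B + twiceEdges G A∩B ∎
    where
    open ≤-Reasoning
    A∪B A∩B : VSubset G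
    A∪B x = A x ∨ B x
    A∩B x = A x ∧ B x
    e : VSubset G → VSubset G → Fin (n G) → Fin (n G) → ℕ
    e C D x y = ι (C x ∧ D y ∧ adj G x y)
    twiceEdges≡∑∑ : ∀ S → twiceEdges G S ≡ sum (λ x → sum (e S S x))
    twiceEdges≡∑∑ S = trans (twiceEdges≡crossEdges G S) (crossEdges≡∑∑ S S)
    pointwise : ∀ a b a′ b′ e → ι (a ∧ b′ ∧ e) + ι (b ∧ a′ ∧ e)
      ≤ ι ((a ∨ b) ∧ (a′ ∨ b′) ∧ e) + ι ((a ∧ b) ∧ (a′ ∧ b′) ∧ e)
    pointwise true  true  true  true  e = ≤-refl
    pointwise true  true  true  false e = ≤-reflexive (+-comm 0 (ι e))
    pointwise true  true  false b′    e = ≤-refl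
    pointwise true  false true  true  e = ≤-refl
    pointwise true  false true  false e = z≤n
    pointwise true  false false b′    e = ≤-refl
    pointwise false true  true  b′    e = ≤-reflexive (+-comm 0 (ι e))
    pointwise false true  false b′    e = z≤n
    pointwise false false a′    b′    e = z≤n

  -- Only vertices of `Z` contribute to the truncated sum, which is therefore `crossEdges G Z S`
  -- less `k * count Z`. Adding `k * count Z` to both sides keeps the argument free of subtraction.
  excess-bound : ∀ k S → madLe G (2 * k) → sum (λ z → degIn G S z ∸ k) ≤ k * count S
  excess-bound k S mad≤ = +-cancelʳ-≤ (k * count Z) _ _ (*-cancelˡ-≤ 2 doubled)
    where
    s = degIn G S
    Z : VSubset G
    Z z = ⌊ k ≤? s z ⌋
    pointwise : ∀ z → (s z ∸ k) + k * ι (Z z) ≡ ι (Z z) * s z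
    pointwise z with k ≤? s z
    ... | yes k≤s = trans (cong (s z ∸ k +_) (*-identityʳ k))
                      (trans (m∸n+n≡m k≤s) (≡.sym (*-identityˡ (s z))))
    ... | no  k≰s = cong₂ _+_ (m≤n⇒m∸n≡0 (<⇒≤ (≰⇒> k≰s))) (*-zeroʳ k)
    regroup : ∀ k z s → 2 * k * (z + s) ≡ 2 * (k * s + k * z)
    regroup = solve-∀
    open ≤-Reasoning
    split : sum (λ z → s z ∸ k) + k * count Z ≡ crossEdges G Z S
    split = begin-equality
      sum (λ z → s z ∸ k) + k * count Z
        ≡⟨ cong (λ t → sum (λ z → s z ∸ k) + k * t) (count≡sum Z) ⟩
      sum (λ z → s z ∸ k) + k * sum (ι ∘ Z)
        ≡⟨ cong (sum (λ z → s z ∸ k) +_) (*-distribˡ-sum k (ι ∘ Z)) ⟩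
      sum (λ z → s z ∸ k) + sum (λ z → k * ι (Z z))
        ≡⟨ ∑-distrib-+ (λ z → s z ∸ k) (λ z → k * ι (Z z)) ⟨
      sum (λ z → (s z ∸ k) + k * ι (Z z))
        ≡⟨ sum-cong-≗ pointwise ⟩
      sum (λ z → ι (Z z) * s z)
        ≡⟨ crossEdges≡sum-degIn Z S ⟨
      crossEdges G Z S ∎
    doubled : 2 * (sum (λ z → s z ∸ k) + k * count Z) ≤ 2 * (k * count S + k * count Z)
    doubled = begin
      2 * (sum (λ z → s z ∸ k) + k * count Z)
        ≡⟨ cong (2 *_) split ⟩
      2 * crossEdges G Z S
        -- The second of the two copies is turned around by symmetry, to match the left side of the
        -- uncrossing inequality.
        ≡⟨ cong (crossEdges G Z S +_) (trans (+-identityʳ _) (crossEdges-sym Z S)) ⟩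
      crossEdges G Z S + crossEdges G S Z
        ≤⟨ crossEdges-uncross Z S ⟩
      twiceEdges G (λ x → Z x ∨ S x) + twiceEdges G (λ x → Z x ∧ S x)
        ≤⟨ +-mono-≤ (mad≤ _) (mad≤ _) ⟩
      2 * k * count (λ x → Z x ∨ S x) + 2 * k * count (λ x → Z x ∧ S x)
        ≡⟨ *-distribˡ-+ (2 * k) (count (λ x → Z x ∨ S x)) _ ⟨
      2 * k * (count (λ x → Z x ∨ S x) + count (λ x → Z x ∧ S x))
        -- The sizes of union and intersection add up to those of `Z` and `S`, so an overlap of `Z`
        -- with `S` costs nothing.
        ≡⟨ cong (2 * k *_) (count-∪-∩ Z S) ⟩
      2 * k * (count Z + count S)
        ≡⟨ regroup k (count Z) (count S) ⟩
      2 * (k * count S + k * count Z) ∎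

  -- Neighbourhoods in the square

  -- Double counting of the adjacent pairs `(x , z)` with `x` in `S`: each `z` carries its weight
  -- once per neighbour in `S`. It is applied with weight 1 for degrees, with an adjacency indicator
  -- for 2-walks, and with `degIn G S` for the sum of squares.
  ∑-neighbours : ∀ S (g : Fin (n G) → ℕ) →
    sum (λ x → ι (S x) * sum (λ z → ι (adj G x z) * g z)) ≡ sum (λ z → degIn G S z * g z)
  ∑-neighbours S g = begin
    sum (λ x → ι (S x) * sum (λ z → ι (adj G x z) * g z))
      ≡⟨ sum-cong-≗ (λ x → *-distribˡ-sum (ι (S x)) (λ z → ι (adj G x z) * g z)) ⟩
    sum (λ x → sum (λ z → ι (S x) * (ι (adj G x z) * g z)))
      ≡⟨ ∑-comm (λ x z → ι (S x) * (ι (adj G x z) * g z)) ⟩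
    sum (λ z → sum (λ x → ι (S x) * (ι (adj G x z) * g z)))
      ≡⟨ sum-cong-≗ (λ z → sum-cong-≗ λ x → regroup x z) ⟩
    sum (λ z → sum (λ x → ι (S x) * ι (adj G z x) * g z))
      ≡⟨ sum-cong-≗ (λ z → *-distribʳ-sum (g z) (λ x → ι (S x) * ι (adj G z x))) ⟨
    sum (λ z → sum (λ x → ι (S x) * ι (adj G z x)) * g z)
      ≡⟨ sum-cong-≗ (λ z → cong (_* g z) (count-∧ S (adj G z))) ⟨
    sum (λ z → degIn G S z * g z) ∎
    where
    open ≡.≡-Reasoning
    regroup : ∀ x z → ι (S x) * (ι (adj G x z) * g z) ≡ ι (S x) * ι (adj G z x) * g z
    regroup x z rewrite Graph.sym G x z = ≡.sym (*-assoc (ι (S x)) _ (g z))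

  ∑-deg : ∀ S → sum (λ x → ι (S x) * deg G x) ≡ sum (degIn G S)
  ∑-deg S = begin
    sum (λ x → ι (S x) * deg G x)
      ≡⟨ sum-cong-≗ (λ x → cong (ι (S x) *_) (trans (count≡sum (adj G x))
           (sum-cong-≗ λ z → ≡.sym (*-identityʳ (ι (adj G x z)))))) ⟩
    sum (λ x → ι (S x) * sum (λ z → ι (adj G x z) * 1))
      ≡⟨ ∑-neighbours S (λ _ → 1) ⟩
    sum (λ z → degIn G S z * 1)
      ≡⟨ sum-cong-≗ (λ z → *-identityʳ (degIn G S z)) ⟩
    sum (degIn G S) ∎
    where open ≡.≡-Reasoning

  deg≤Δ : ∀ x → deg G x ≤ Δ G
  deg≤Δ = ≤maxF (deg G)

  degIn≤Δ : ∀ S x → degIn G S x ≤ Δ G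
  degIn≤Δ S x = ≤-trans (count-mono λ y → proj₂ ∘ ∧-true {p = S y}) (deg≤Δ x)

  -- Its form is the one in which `Degenerate` counts neighbours, with the relation used by
  -- `degenerate⇒colLe`.
  closedDeg²In : VSubset G → Fin (n G) → ℕ
  closedDeg²In S x = count (λ y → S y ∧ (⌊ y ≟ x ⌋ ∨ adj² G x y))

  walks₂ : Fin (n G) → Fin (n G) → ℕ
  walks₂ x y = count (λ z → adj G x z ∧ adj G z y)

  walks₂-closed : ∀ x → walks₂ x x ≡ deg G x
  walks₂-closed x = count-cong λ z →
    trans (cong (adj G x z ∧_) (Graph.sym G z x)) (∧-idem (adj G x z))

  ∑-walks₂ : ∀ S x → sum (λ y → ι (S y) * walks₂ x y) ≡ sum (λ z → ι (adj G x z) * degIn G S z)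
  ∑-walks₂ S x = begin
    sum (λ y → ι (S y) * walks₂ x y)
      ≡⟨ sum-cong-≗ (λ y → cong (ι (S y) *_) (trans (count-∧ (adj G x) (λ z → adj G z y)) (sum-cong-≗ (flip y)))) ⟩
    sum (λ y → ι (S y) * sum (λ z → ι (adj G y z) * ι (adj G x z)))
      ≡⟨ ∑-neighbours S (λ z → ι (adj G x z)) ⟩
    sum (λ z → degIn G S z * ι (adj G x z))
      ≡⟨ sum-cong-≗ (λ z → *-comm (degIn G S z) _) ⟩
    sum (λ z → ι (adj G x z) * degIn G S z) ∎
    where
    open ≡.≡-Reasoning
    flip : ∀ y z → ι (adj G x z) * ι (adj G z y) ≡ ι (adj G y z) * ι (adj G x z)
    flip y z = trans (*-comm (ι (adj G x z)) _) (cong (λ e → ι e * ι (adj G x z)) (Graph.sym G z y))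

  -- The term deg x pays for the closed walks x z x, which are not neighbours.
  closedDeg²In-bound : ∀ S x → S x ≡ true → closedDeg²In S x + deg G x
    ≤ 1 + degIn G S x + sum (λ z → ι (adj G x z) * degIn G S z)
  closedDeg²In-bound S x Sx = begin
    closedDeg²In S x + deg G x
      ≡⟨ cong₂ _+_ (count≡sum near)
           (trans (≡.sym (walks₂-closed x)) (≡.sym (sum-point x (walks₂ x)))) ⟩
    sum (ι ∘ near) + sum (λ y → ι ⌊ y ≟ x ⌋ * walks₂ x y)
      ≡⟨ ∑-distrib-+ (ι ∘ near) (λ y → ι ⌊ y ≟ x ⌋ * walks₂ x y) ⟨
    sum (λ y → ι (near y) + ι ⌊ y ≟ x ⌋ * walks₂ x y)
      ≤⟨ sum-mono pointwise ⟩
    sum (λ y → ι ⌊ y ≟ x ⌋ * 1 + ι (S y ∧ adj G x y) + ι (S y) * walks₂ x y)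
      ≡⟨ ∑-distrib-+ (λ y → ι ⌊ y ≟ x ⌋ * 1 + ι (S y ∧ adj G x y)) (λ y → ι (S y) * walks₂ x y) ⟩
    sum (λ y → ι ⌊ y ≟ x ⌋ * 1 + ι (S y ∧ adj G x y)) + sum (λ y → ι (S y) * walks₂ x y)
      ≡⟨ cong₂ _+_ (∑-distrib-+ (λ y → ι ⌊ y ≟ x ⌋ * 1) (λ y → ι (S y ∧ adj G x y))) (∑-walks₂ S x) ⟩
    sum (λ y → ι ⌊ y ≟ x ⌋ * 1) + sum (λ y → ι (S y ∧ adj G x y)) + t
      ≡⟨ cong (_+ t) (cong₂ _+_ (sum-point x (λ _ → 1)) (≡.sym (count≡sum (λ y → S y ∧ adj G x y)))) ⟩
    1 + degIn G S x + t ∎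
    where
    open ≤-Reasoning
    t = sum (λ z → ι (adj G x z) * degIn G S z)
    near : VSubset G
    near y = S y ∧ (⌊ y ≟ x ⌋ ∨ adj² G x y)
    adj²-bound : ∀ y → ι (adj² G x y) ≤ ι (adj G x y) + walks₂ x y
    adj²-bound y = ≤-trans (ι-mono (proj₂ ∘ ∧-true {p = not ⌊ x ≟ y ⌋}))
      (≤-trans (ι-∨ (adj G x y) _) (+-monoʳ-≤ (ι (adj G x y)) (ι-anyF≤count (λ z → adj G x z ∧ adj G z y))))
    pointwise : ∀ y → ι (near y) + ι ⌊ y ≟ x ⌋ * walks₂ x y
      ≤ ι ⌊ y ≟ x ⌋ * 1 + ι (S y ∧ adj G x y) + ι (S y) * walks₂ x y
    pointwise y with y ≟ x
    -- Since `x` lies in `S`, the closed walks at `x` occur on both sides and match; the delta term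
    -- pays for `x` itself.
    ... | yes refl rewrite Sx = +-monoˡ-≤ (1 * walks₂ x x) (m≤m+n 1 (ι (adj G x x)))
    ... | no  _ with S y
    ...   | false = z≤n
    -- Away from `x`, a neighbour in the square is reached by an edge or by at least one 2-walk.
    ...   | true  = ≤-trans (≤-reflexive (+-identityʳ _)) (≤-trans (adj²-bound y)
                      (≤-reflexive (cong (ι (adj G x y) +_) (≡.sym (*-identityˡ (walks₂ x y))))))

  -- Averaging over a vertex set

  -- The pointwise bound is summed over `S`. By double counting the degrees add up to
  -- `sum (degIn G S)`, which is the correction from the sum of s(z)² to that of s(z)(s(z) - 1),
  -- kept on the left to avoid subtraction.
  ∑-closedDeg²In : ∀ S → sum (λ x → ι (S x) * closedDeg²In S x) + sum (degIn G S)
    ≤ count S + twiceEdges G S + sum (λ z → degIn G S z * degIn G S z)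
  ∑-closedDeg²In S = begin
    sum (λ x → ι (S x) * closedDeg²In S x) + sum s
      ≡⟨ cong (sum (λ x → ι (S x) * closedDeg²In S x) +_) (∑-deg S) ⟨
    sum (λ x → ι (S x) * closedDeg²In S x) + sum (λ x → ι (S x) * deg G x)
      ≡⟨ ∑-distrib-+ (λ x → ι (S x) * closedDeg²In S x) (λ x → ι (S x) * deg G x) ⟨
    sum (λ x → ι (S x) * closedDeg²In S x + ι (S x) * deg G x)
      ≤⟨ sum-mono pointwise ⟩
    sum (λ x → ι (S x) + ι (S x) * s x + ι (S x) * t x)
      ≡⟨ ∑-distrib-+ (λ x → ι (S x) + ι (S x) * s x) (λ x → ι (S x) * t x) ⟩
    sum (λ x → ι (S x) + ι (S x) * s x) + sum (λ x → ι (S x) * t x)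
      ≡⟨ cong (_+ sum (λ x → ι (S x) * t x)) (∑-distrib-+ (ι ∘ S) (λ x → ι (S x) * s x)) ⟩
    sum (ι ∘ S) + sum (λ x → ι (S x) * s x) + sum (λ x → ι (S x) * t x)
      ≡⟨ cong₂ _+_ (cong₂ _+_ (count≡sum S) (trans (twiceEdges≡crossEdges G S) (crossEdges≡sum-degIn S S)))
           (≡.sym (∑-neighbours S s)) ⟨
    count S + twiceEdges G S + sum (λ z → s z * s z) ∎
    where
    open ≤-Reasoning
    s = degIn G S
    t : Fin (n G) → ℕ
    t x = sum (λ z → ι (adj G x z) * s z)
    pointwise : ∀ x → ι (S x) * closedDeg²In S x + ι (S x) * deg G x ≤ ι (S x) + ι (S x) * s x + ι (S x) * t x
    pointwise x with S x in Sx
    ... | false = z≤n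
    ... | true rewrite *-identityˡ (closedDeg²In S x) | *-identityˡ (deg G x) | *-identityˡ (s x) | *-identityˡ (t x)
      = closedDeg²In-bound S x Sx

  ∑-degIn : ∀ S → sum (degIn G S) ≤ Δ G * count S
  ∑-degIn S = begin
    sum (degIn G S)                ≡⟨ ∑-deg S ⟨
    sum (λ x → ι (S x) * deg G x)  ≤⟨ sum-mono (λ x → *-monoʳ-≤ (ι (S x)) (deg≤Δ x)) ⟩
    sum (λ x → ι (S x) * Δ G)      ≡⟨ *-distribʳ-sum (Δ G) (ι ∘ S) ⟨
    sum (ι ∘ S) * Δ G              ≡⟨ cong (_* Δ G) (count≡sum S) ⟨
    count S * Δ G                  ≡⟨ *-comm (count S) (Δ G) ⟩
    Δ G * count S                  ∎
    where open ≤-Reasoning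

  -- One factor s(z) is split as at most `k` plus its excess over `k`; the other factor is replaced
  -- by `Δ G` only where it multiplies the excess.
  ∑-degIn² : ∀ k S → madLe G (2 * k) →
    sum (λ z → degIn G S z * degIn G S z) ≤ k * sum (degIn G S) + Δ G * (k * count S)
  ∑-degIn² k S mad≤ = begin
    sum (λ z → s z * s z)
      ≤⟨ sum-mono pointwise ⟩
    sum (λ z → k * s z + Δ G * (s z ∸ k))
      ≡⟨ ∑-distrib-+ (λ z → k * s z) (λ z → Δ G * (s z ∸ k)) ⟩
    sum (λ z → k * s z) + sum (λ z → Δ G * (s z ∸ k))
      ≡⟨ cong₂ _+_ (*-distribˡ-sum k s) (*-distribˡ-sum (Δ G) (λ z → s z ∸ k)) ⟨
    k * sum s + Δ G * sum (λ z → s z ∸ k)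
      ≤⟨ +-monoʳ-≤ (k * sum s) (*-monoʳ-≤ (Δ G) (excess-bound k S mad≤)) ⟩
    k * sum s + Δ G * (k * count S) ∎
    where
    open ≤-Reasoning
    s = degIn G S
    pointwise : ∀ z → s z * s z ≤ k * s z + Δ G * (s z ∸ k)
    pointwise z = begin
      s z * s z                    ≤⟨ *-monoˡ-≤ (s z) (m≤n+m∸n (s z) k) ⟩
      (k + (s z ∸ k)) * s z        ≡⟨ *-distribʳ-+ (s z) k (s z ∸ k) ⟩
      k * s z + (s z ∸ k) * s z    ≤⟨ +-monoʳ-≤ (k * s z) (*-monoʳ-≤ (s z ∸ k) (degIn≤Δ S z)) ⟩
      k * s z + (s z ∸ k) * Δ G    ≡⟨ cong (k * s z +_) (*-comm (s z ∸ k) (Δ G)) ⟩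
      k * s z + Δ G * (s z ∸ k)    ∎

  -- Here `suc k` plays the part of the theorem's k, which makes the k - 1 left after the
  -- cancellation an honest natural number.
  average-closedDeg²In : ∀ k S → madLe G (2 * suc k) →
    sum (λ x → ι (S x) * closedDeg²In S x) ≤ ((2 * suc k ∸ 1) * Δ G + 2 * suc k + 1) * count S
  average-closedDeg²In k S mad≤ = +-cancelʳ-≤ (sum s) _ _ (begin
    sum (λ x → ι (S x) * closedDeg²In S x) + sum s
      ≤⟨ ∑-closedDeg²In S ⟩
    count S + twiceEdges G S + sum (λ z → s z * s z)
      ≤⟨ +-mono-≤ (+-monoʳ-≤ (count S) (mad≤ S)) (∑-degIn² (suc k) S mad≤) ⟩
    count S + 2 * suc k * count S + (sum s + k * sum s + Δ G * (suc k * count S))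
      -- Of the `suc k` copies of `sum s`, one is kept to cancel the copy on the left; only the
      -- other `k` are bounded through `Δ G`.
      ≤⟨ +-monoʳ-≤ (count S + 2 * suc k * count S) (+-monoˡ-≤ (Δ G * (suc k * count S))
           (+-monoʳ-≤ (sum s) (*-monoʳ-≤ k (∑-degIn S)))) ⟩
    count S + 2 * suc k * count S + (sum s + k * (Δ G * count S) + Δ G * (suc k * count S))
      ≡⟨ regroup k (count S) (sum s) (Δ G) ⟩
    ((2 * suc k ∸ 1) * Δ G + 2 * suc k + 1) * count S + sum s ∎)
    where
    open ≤-Reasoning
    s = degIn G S
    -- The coefficient `k + (suc k + 0)` is what `2 * suc k ∸ 1` computes to: `k` from the kept
    -- degrees and `suc k` from the excess.
    regroup : ∀ k c t d → c + 2 * suc k * c + (t + k * (d * c) + d * (suc k * c))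
      ≡ ((k + (suc k + 0)) * d + 2 * suc k + 1) * c + t
    regroup = solve-∀

theorem3p8 : (k : ℕ) → 0 < k → (G : Graph) →
    madGt G (2 * k ∸ 2) → madLe G (2 * k) →
    colLe (adj² G) ((2 * k ∸ 1) * Δ G + 2 * k + 1)
theorem3p8 (suc k) _ G _ mad≤ = degenerate⇒colLe (adj² G) _ λ S 0<S →
  ∃≤average S (closedDeg²In G S) _ 0<S (average-closedDeg²In G k S mad≤)
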